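{- Let $G=G(V,E)$ be a finite simple graph and let $n\ge |V|$ be an integer. Then $$\mathrm{lbal}(n,G)\le \frac{1}{2}\binom{n}{2}+\left\lceil \frac{\mathrm{ex}(n,\mathcal{H}(G))}{2}\right\rceil .$$
   Context: A 2-list coloring of the edges of $K_n$ is a function $L:E(K_n)\to\{\{r\},\{b\},\{r,b\}\}$; it induces color classes $R=\{e: r\in L(e)\}$ and $B=\{e: b\in L(e)\}$ (which may intersect). Given a 2-list coloring with color classes $R,B$, a balanced copy of a graph $G=G(V,E)$ is a (not necessarily induced) copy of $G$ in $K_n$ whose edge set has a partition $E_1\sqcup E_2$ with $E_1\subseteq R$, $E_2\subseteq B$ and $\bigl||E_1|-|E_2|\bigr|\le 1$. For $n\ge |V|$, the list balancing number $\mathrm{lbal}(n,G)$ is the smallest integer $k$ such that every 2-list coloring of the edges of $K_n$ with color classes satisfying $|R|,|B|>k$ contains a balanced copy of $G$. Let $\mathcal{H}(G)$ be the family of all subgraphs $H$ of $G$ with exactly $e(H)=\lfloor e(G)/2\rfloor$ edges and with no isolated vertices, where $e(\cdot)$ denotes the number of edges. For a graph family $\mathcal{F}$, $\mathrm{ex}(n,\mathcal{F})$ is the largest number of edges in a graph of order $n$ that contains no member of $\mathcal{F}$ as a (not necessarily induced) subgraph. -}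

module Defs where

open import Data.Empty.Irrelevant renaming (⊥-elim to ⊥-elim-irr)
open import Data.Fin.Base as Fin using (Fin; zero; suc)
open import Data.Fin.Properties as Fin using (any?; all?; <-cmp)
open import Data.List.Base as List
  using (List; []; _∷_; _++_; length; map; filter; allFin)
open import Data.List.Membership.Propositional using (_∈_)
open import Data.List.Membership.Propositional.Properties
  using (∈-map⁺; ∈-++⁺ˡ; ∈-++⁺ʳ; ∈-allFin; ∈-lookup)
import Data.List.Membership.Setoid.Properties as Membership
open import Data.List.Properties using (map-cong; filter-≐; length-filter)
open import Data.List.Relation.Binary.Subset.Propositional using (_⊆_)
import Data.List.Relation.Binary.Subset.DecPropositional as DecSubset
open import Data.List.Relation.Ternary.Interleaving.Propositional
  using (Interleaving; []; consˡ; consʳ)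
open import Data.List.Relation.Unary.All as All using (All; []; _∷_)
open import Data.List.Relation.Unary.AllPairs using ([]; _∷_)
open import Data.List.Relation.Unary.Any as Any using (Any)
open import Data.List.Relation.Unary.Any.Properties using (lookup-index)
open import Data.List.Relation.Unary.Unique.Propositional using (Unique)
import Data.List.Relation.Unary.Unique.DecPropositional as DecUnique
open import Data.Nat.Base as ℕ
  using (ℕ; zero; suc; _≤_; _<_; s≤s; ∣_-_∣; ⌊_/2⌋)
open import Data.Nat.Properties as ℕ
  using (≤-pred; <⇒≱; ≤∧≢⇒<; anyUpTo?)
open import Data.Product.Base using (Σ; ∃; ∃₂; _×_; _,_; proj₁; proj₂)
open import Data.Sum.Base using (_⊎_; inj₁; inj₂; [_,_]′)
open import Data.Vec.Base as Vec using (Vec; []; _∷_)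
open import Data.Vec.Properties using (lookup∘tabulate)
open import Function.Base using (_∘_; _$_)
open import Function.Bundles using (_↣_; mk↣; Injection)
open import Function.Definitions using (Injective)
open import Relation.Binary.Definitions
  using (DecidableEquality; tri<; tri≈; tri>)
open import Relation.Binary.PropositionalEquality
  using (_≡_; _≢_; _≗_; refl; sym; trans; cong; subst; subst₂; setoid)
open import Relation.Nullary.Decidable
  using (Dec; yes; no; map′; ¬?; _×-dec_; _⊎-dec_; _→-dec_; decidable-stable)
open import Relation.Nullary.Negation using (¬_; contradiction)
open import Relation.Unary using (Decidable)

------------------------------------------------------------------------
-- Graphs

-- The unordered pair {lo , hi} of distinct elements of Fin n.
record Edge (n : ℕ) : Set where
  constructor mkEdge
  field
    lo hi : Fin n
    lo<hi : lo Fin.< hi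

open Edge public

edge : ∀ {n} (i j : Fin n) → .(i ≢ j) → Edge n
edge i j i≢j with <-cmp i j
... | tri< i<j _ _ = mkEdge i j i<j
... | tri≈ _ i≡j _ = ⊥-elim-irr (i≢j i≡j)
... | tri> _ _ j<i = mkEdge j i j<i

-- The edges of the complete graph on Fin n, each listed once.
allEdges : ∀ n → List (Edge n)
allEdges zero    = []
allEdges (suc n) =
  map (λ j → mkEdge zero (suc j) (s≤s ℕ.z≤n)) (allFin n) ++
  map (λ e → mkEdge (suc (lo e)) (suc (hi e)) (s≤s (lo<hi e))) (allEdges n)

-- Simple graphs with vertex set Fin v; the order of the list is immaterial.
record Graph (v : ℕ) : Set where
  constructor mkGraph
  field
    edges  : List (Edge v)
    unique : Unique edges

open Graph public

e[_] : ∀ {v} → Graph v → ℕ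
e[ G ] = length (edges G)

mapEdge : ∀ {m n} → Fin m ↣ Fin n → Edge m → Edge n
mapEdge f e = edge (to (lo e)) (to (hi e))
  (λ eq → Fin.<-irrefl (injective eq) (lo<hi e))
  where open Injection f

-- The edge set of the copy of H in the complete graph on Fin n whose
-- vertices are the images of those of H under f.
copyEdges : ∀ {m n} → Fin m ↣ Fin n → Graph m → List (Edge n)
copyEdges f H = map (mapEdge f) (edges H)

-- X contains a (not necessarily induced) copy of H.
_⊑_ : ∀ {m n} → Graph m → Graph n → Set
_⊑_ {m} {n} H X = ∃ λ (f : Fin m ↣ Fin n) → copyEdges f H ⊆ edges X

NoIsolatedVertices : ∀ {v} → Graph v → Set
NoIsolatedVertices {v} H =
  ∀ (i : Fin v) → Any (λ e → lo e ≡ i ⊎ hi e ≡ i) (edges H)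

------------------------------------------------------------------------
-- List colorings

data Colour : Set where
  red blue : Colour

-- The nonempty subsets {r}, {b} and {r,b} of the set of colours.
data Palette : Set where
  r b rb : Palette

infix 4 _∈ᵖ_ _∈ᵖ?_

data _∈ᵖ_ : Colour → Palette → Set where
  red∈r   : red  ∈ᵖ r
  red∈rb  : red  ∈ᵖ rb
  blue∈b  : blue ∈ᵖ b
  blue∈rb : blue ∈ᵖ rb

_∈ᵖ?_ : ∀ c p → Dec (c ∈ᵖ p)
red  ∈ᵖ? r  = yes red∈r
red  ∈ᵖ? b  = no λ ()
red  ∈ᵖ? rb = yes red∈rb
blue ∈ᵖ? r  = no λ ()
blue ∈ᵖ? b  = yes blue∈b
blue ∈ᵖ? rb = yes blue∈rb

ListColoring : ℕ → Set
ListColoring n = Edge n → Palette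

class : ∀ {n} → Colour → ListColoring n → List (Edge n)
class {n} c L = filter (λ e → c ∈ᵖ? L e) (allEdges n)

-- Interleaving E₁ E₂ xs: the list xs is split into E₁ and E₂, every
-- position of xs going to exactly one of them.
BalancedPartition : ∀ {n} (R B xs : List (Edge n)) → Set
BalancedPartition R B xs = ∃₂ λ E₁ E₂ →
  Interleaving E₁ E₂ xs × E₁ ⊆ R × E₂ ⊆ B × ∣ length E₁ - length E₂ ∣ ≤ 1

HasBalancedCopy : ∀ {v n} → Graph v → ListColoring n → Set
HasBalancedCopy {v} {n} G L = ∃ λ (f : Fin v ↣ Fin n) →
  BalancedPartition (class red L) (class blue L) (copyEdges f G)

ForcesBalancedCopy : ∀ {v} → ℕ → Graph v → ℕ → Set
ForcesBalancedCopy n G k = ∀ (L : ListColoring n) →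
  k < length (class red L) → k < length (class blue L) → HasBalancedCopy G L

-- Applied to ForcesBalancedCopy n G. Minimising over ℤ gives nothing else
-- when it makes sense: if v ≤ n and G has at least two edges, coloring
-- every edge of the complete graph with {r} rules out all k < 0; if G has
-- at most one edge, every integer k qualifies and only the minimum over ℕ
-- exists.
IsLeast : (ℕ → Set) → ℕ → Set
IsLeast P k = P k × (∀ j → P j → k ≤ j)

------------------------------------------------------------------------
-- Forbidden families

ContainsMember : (∀ {m} → Graph m → Set) → ∀ {n} → Graph n → Set
ContainsMember F X = ∃ λ m → ∃ λ (H : Graph m) → F H × H ⊑ X

-- Containment is required to be decidable so that the extremal number is
-- a natural number constructively.
record GraphFamily : Set₁ where
  field
    Member          : ∀ {m} → Graph m → Set
    containsMember? : ∀ {n} (X : Graph n) → Dec (ContainsMember Member X)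

  Free : ∀ {n} → Graph n → Set
  Free X = ¬ ContainsMember Member X

-- If no graph of order n is free of the family (which happens if it has
-- the graph without vertices as a member), the maximum is over the empty
-- set and is taken to be 0.
data IsEx (n : ℕ) (F : GraphFamily) : ℕ → Set where
  largest : (X : Graph n) → GraphFamily.Free F X →
            (∀ (Y : Graph n) → GraphFamily.Free F Y → e[ Y ] ≤ e[ X ]) →
            IsEx n F e[ X ]
  none    : (∀ (Y : Graph n) → ¬ GraphFamily.Free F Y) → IsEx n F 0

-- Membership is up to isomorphism: H is isomorphic to a subgraph of G.
HalfSubgraph : ∀ {v} → Graph v → ∀ {m} → Graph m → Set
HalfSubgraph G H = H ⊑ G × e[ H ] ≡ ⌊ e[ G ] /2⌋ × NoIsolatedVertices H

------------------------------------------------------------------------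
-- Decidability by exhaustive search

infix 4 _≟ᵉ_

_≟ᵉ_ : ∀ {n} → DecidableEquality (Edge n)
mkEdge i j p ≟ᵉ mkEdge i′ j′ p′ with i Fin.≟ i′ | j Fin.≟ j′
... | yes refl | yes refl = yes (cong (mkEdge i j) (Fin.<-irrelevant p p′))
... | no i≢i′  | _        = no λ { refl → i≢i′ refl }
... | yes _    | no j≢j′  = no λ { refl → j≢j′ refl }

∈-allEdges : ∀ {n} (e : Edge n) → e ∈ allEdges n
∈-allEdges (mkEdge zero (suc j) (s≤s ℕ.z≤n)) =
  ∈-++⁺ˡ (∈-map⁺ _ (∈-allFin j))
∈-allEdges (mkEdge (suc i) (suc j) (s≤s i<j)) =
  ∈-++⁺ʳ _ (∈-map⁺ _ (∈-allEdges (mkEdge i j i<j)))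

edge-cong : ∀ {n} {i i′ j j′ : Fin n} .{p : i ≢ j} .{p′ : i′ ≢ j′} →
            i ≡ i′ → j ≡ j′ → edge i j p ≡ edge i′ j′ p′
edge-cong refl refl = refl

lookup-injective : ∀ {A : Set} {xs : List A} → Unique xs →
                   Injective _≡_ _≡_ (List.lookup xs)
lookup-injective (_ ∷ _)  {zero}  {zero}  _  = refl
lookup-injective {xs = _ ∷ xs} (p ∷ _) {zero} {suc j} eq =
  contradiction eq (All.lookup p (∈-lookup {xs = xs} j))
lookup-injective {xs = _ ∷ xs} (p ∷ _) {suc i} {zero} eq =
  contradiction (sym eq) (All.lookup p (∈-lookup {xs = xs} i))
lookup-injective (_ ∷ us) {suc i} {suc j} eq =
  cong suc (lookup-injective us eq)

e≤ : ∀ {n} (X : Graph n) → e[ X ] ≤ length (allEdges n)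
e≤ X = Fin.injective⇒≤ {f = Any.index ∘ ∈-allEdges ∘ List.lookup (edges X)}
  (lookup-injective (unique X) ∘
   Membership.index-injective (setoid _) (∈-allEdges _) (∈-allEdges _))

Searchable : Set → Set₁
Searchable A = ∀ {P : A → Set} → Decidable P → Dec (∃ P)

search⇒all? : ∀ {A} → Searchable A → ∀ {P : A → Set} → Decidable P →
              Dec (∀ x → P x)
search⇒all? search P? with search (¬? ∘ P?)
... | yes (x , ¬px) = no λ ∀p → ¬px (∀p x)
... | no ¬∃¬        = yes λ x → decidable-stable (P? x) (λ ¬px → ¬∃¬ (x , ¬px))

searchPalette : Searchable Palette
searchPalette P? =
  map′ [ r ,_ , [ b ,_ , rb ,_ ]′ ]′
       (λ { (r , p) → inj₁ p ; (b , p) → inj₂ (inj₁ p) ; (rb , p) → inj₂ (inj₂ p) })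
       (P? r ⊎-dec P? b ⊎-dec P? rb)

searchEdge : ∀ {n} → Searchable (Edge n)
searchEdge P? =
  map′ Any.satisfied (λ { (e , p) → Any.map (λ { refl → p }) (∈-allEdges e) })
       (Any.any? P? (allEdges _))

searchVec : ∀ {A} → Searchable A → ∀ k → Searchable (Vec A k)
searchVec search zero    P? = map′ ([] ,_) (λ { ([] , p) → p }) (P? [])
searchVec search (suc k) P? =
  map′ (λ { (x , xs , p) → x ∷ xs , p }) (λ { (x ∷ xs , p) → x , xs , p })
       (search λ x → searchVec search k (P? ∘ (x ∷_)))

searchList≤ : ∀ {A} → Searchable A → ∀ k {P : List A → Set} → Decidable P →
              Dec (∃ λ xs → length xs ≤ k × P xs)
searchList≤ search zero P? =
  map′ (λ p → [] , ℕ.z≤n , p) (λ { ([] , _ , p) → p }) (P? [])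
searchList≤ search (suc k) P? =
  map′ [ (λ p → [] , ℕ.z≤n , p)
       , (λ { (x , xs , l , p) → x ∷ xs , s≤s l , p }) ]′
       (λ { ([] , _ , p) → inj₁ p
          ; (x ∷ xs , s≤s l , p) → inj₂ (x , xs , l , p) })
       (P? [] ⊎-dec search λ x → searchList≤ search k (P? ∘ (x ∷_)))

searchGraph : ∀ {n} {P : Graph n → Set} →
              (∀ {xs u u′} → P (mkGraph xs u) → P (mkGraph xs u′)) →
              Decidable P → Dec (∃ P)
searchGraph {n} {P} resp P? =
  map′ (λ { (xs , _ , u , p) → mkGraph xs u , p })
       (λ { (X , p) → edges X , e≤ X , unique X , p })
       (searchList≤ searchEdge (length (allEdges n)) Q?)
  where
  Q? : Decidable (λ xs → Σ (Unique xs) λ u → P (mkGraph xs u))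
  Q? xs with DecUnique.unique? _≟ᵉ_ xs
  ... | no ¬u = no (¬u ∘ proj₁)
  ... | yes u = map′ (u ,_) (λ { (u′ , p) → resp p }) (P? (mkGraph xs u))

searchCopy : ∀ {m n} (H : Graph m) {P : List (Edge n) → Set} → Decidable P →
             Dec (∃ λ (f : Fin m ↣ Fin n) → P (copyEdges f H))
searchCopy {m} {n} H {P} P? =
  map′ (λ { (v , inj , p) → mk↣ (λ {i} {j} → inj i j) , p })
       from
       (searchVec any? m Q?)
  where
  Inj : Vec (Fin n) m → Set
  Inj v = ∀ i j → Vec.lookup v i ≡ Vec.lookup v j → i ≡ j

  Q : Vec (Fin n) m → Set
  Q v = Σ (Inj v) λ inj → P (copyEdges (mk↣ (λ {i} {j} → inj i j)) H)

  resp : (f g : Fin m ↣ Fin n) → Injection.to f ≗ Injection.to g →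
         P (copyEdges f H) → P (copyEdges g H)
  resp f g f≗g =
    subst P (map-cong (λ e → edge-cong (f≗g (lo e)) (f≗g (hi e))) (edges H))

  Q? : Decidable Q
  Q? v with all? (λ i → all? λ j →
            (Vec.lookup v i Fin.≟ Vec.lookup v j) →-dec (i Fin.≟ j))
  ... | no ¬inj = no (¬inj ∘ proj₁)
  ... | yes inj = map′ (inj ,_)
    (λ { (inj′ , p) → resp (mk↣ λ {i} {j} → inj′ i j) (mk↣ λ {i} {j} → inj i j)
                           (λ _ → refl) p })
    (P? _)

  from : (∃ λ f → P (copyEdges f H)) → ∃ Q
  from (f , p) = v , inj , resp f (mk↣ λ {i} {j} → inj i j) (sym ∘ v≗f) p
    where
    open Injection f
    v = Vec.tabulate to
    v≗f : Vec.lookup v ≗ to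
    v≗f = lookup∘tabulate to
    inj : Inj v
    inj i j eq = injective (trans (sym (v≗f i)) (trans eq (v≗f j)))

allColorings? : ∀ {n} {P : ListColoring n → Set} →
                (∀ {L L′} → L ≗ L′ → P L → P L′) →
                Decidable P → Dec (∀ L → P L)
allColorings? {n} {P} resp P? =
  map′ (λ all L → resp (coloring-tabulate L) (all (Vec.tabulate (L ∘ List.lookup xs))))
       (λ all v → all (coloring v))
       (search⇒all? (searchVec searchPalette (length xs)) (P? ∘ coloring))
  where
  xs = allEdges n

  coloring : Vec Palette (length xs) → ListColoring n
  coloring v e = Vec.lookup v (Any.index (∈-allEdges e))

  coloring-tabulate : ∀ L → coloring (Vec.tabulate (L ∘ List.lookup xs)) ≗ L
  coloring-tabulate L e =
    trans (lookup∘tabulate _ (Any.index (∈-allEdges e)))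
          (cong L (sym (lookup-index (∈-allEdges e))))

searchInterleaving : ∀ {A : Set} {P : List A → List A → Set} →
                     (∀ xs ys → Dec (P xs ys)) → ∀ zs →
                     Dec (∃₂ λ xs ys → Interleaving xs ys zs × P xs ys)
searchInterleaving P? [] =
  map′ (λ p → [] , [] , [] , p) (λ { (_ , _ , [] , p) → p }) (P? [] [])
searchInterleaving P? (z ∷ zs) =
  map′ [ (λ { (xs , ys , i , p) → z ∷ xs , ys , consˡ i , p })
       , (λ { (xs , ys , i , p) → xs , z ∷ ys , consʳ i , p }) ]′
       (λ { (_ , _ , consˡ i , p) → inj₁ (_ , _ , i , p)
          ; (_ , _ , consʳ i , p) → inj₂ (_ , _ , i , p) })
       (searchInterleaving (λ xs ys → P? (z ∷ xs) ys) zs ⊎-dec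
        searchInterleaving (λ xs ys → P? xs (z ∷ ys)) zs)

_⊆?_ : ∀ {n} (xs ys : List (Edge n)) → Dec (xs ⊆ ys)
_⊆?_ = DecSubset._⊆?_ _≟ᵉ_

_⊑?_ : ∀ {m n} (H : Graph m) (X : Graph n) → Dec (H ⊑ X)
H ⊑? X = searchCopy H (_⊆? edges X)

hasBalancedCopy? : ∀ {v n} (G : Graph v) (L : ListColoring n) →
                   Dec (HasBalancedCopy G L)
hasBalancedCopy? G L = searchCopy G $ searchInterleaving λ E₁ E₂ →
  (E₁ ⊆? class red L) ×-dec (E₂ ⊆? class blue L) ×-dec
  (∣ length E₁ - length E₂ ∣ ℕ.≤? 1)

class-cong : ∀ {n} {L L′ : ListColoring n} → L ≗ L′ → ∀ c →
             class c L ≡ class c L′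
class-cong {n} L≗L′ c = filter-≐ _ _
  ( (λ {e} → subst (c ∈ᵖ_) (L≗L′ e))
  , (λ {e} → subst (c ∈ᵖ_) (sym (L≗L′ e))) ) (allEdges n)

forcesBalancedCopy? : ∀ {v} n (G : Graph v) → Decidable (ForcesBalancedCopy n G)
forcesBalancedCopy? {v} n G k = allColorings?
  (λ L≗L′ → subst₂ Q (class-cong L≗L′ red) (class-cong L≗L′ blue))
  (λ L → (k ℕ.<? _) →-dec (k ℕ.<? _) →-dec hasBalancedCopy? G L)
  where
  Q : List (Edge n) → List (Edge n) → Set
  Q R B = k < length R → k < length B →
          ∃ λ (f : Fin v ↣ Fin n) → BalancedPartition R B (copyEdges f G)

containsHalfSubgraph? : ∀ {v} (G : Graph v) {n} (X : Graph n) →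
                        Dec (ContainsMember (HalfSubgraph G) X)
containsHalfSubgraph? {v} G X =
  map′ (λ { (m , _ , c) → m , c })
       (λ { (m , H , h@((f , _) , _) , c) →
            m , s≤s (Fin.injective⇒≤ (Injection.injective f)) , H , h , c })
       (anyUpTo? (λ m → searchGraph (λ p → p) λ H →
          ((H ⊑? G) ×-dec (e[ H ] ℕ.≟ _) ×-dec
           all? (λ i → Any.any? (λ e → (lo e Fin.≟ i) ⊎-dec (hi e Fin.≟ i)) (edges H)))
          ×-dec (H ⊑? X)) (suc v))

------------------------------------------------------------------------
-- Existence of the extremal values

least : ∀ {P : ℕ → Set} → Decidable P → ∀ k → P k → ∃ (IsLeast P)
least P? zero    p = zero , p , λ _ _ → ℕ.z≤n
least P? (suc k) p with P? zero
... | yes p₀ = zero , p₀ , λ _ _ → ℕ.z≤n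
... | no ¬p₀ with least (P? ∘ suc) k p
...   | j , pj , min = suc j , pj ,
        λ { zero p₀ → contradiction p₀ ¬p₀ ; (suc i) pi → s≤s (min i pi) }

greatest : ∀ {P : ℕ → Set} → Decidable P → ∀ k → (∀ j → P j → j ≤ k) →
           (∃ λ j → P j × (∀ i → P i → i ≤ j)) ⊎ (∀ j → ¬ P j)
greatest P? k bound with P? k
... | yes p = inj₁ (k , p , bound)
greatest {P} P? zero bound | no ¬p =
  inj₂ λ { j p → ¬p (subst P (ℕ.n≤0⇒n≡0 (bound j p)) p) }
greatest P? (suc k) bound | no ¬p =
  greatest P? k λ j p → ≤-pred (≤∧≢⇒< (bound j p) λ { refl → ¬p p })

lbal-exists : ∀ {v} n (G : Graph v) → ∃ (IsLeast (ForcesBalancedCopy n G))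
lbal-exists n G = least (forcesBalancedCopy? n G) (length (allEdges n))
  λ L k<R → contradiction (length-filter (λ e → red ∈ᵖ? L e) (allEdges n)) (<⇒≱ k<R)

ex-exists : ∀ n (F : GraphFamily) → ∃ (IsEx n F)
ex-exists n F with greatest
  {P = λ k → ∃ λ (X : Graph n) → e[ X ] ≡ k × GraphFamily.Free F X}
  (λ k → searchGraph (λ p → p) λ X →
    (e[ X ] ℕ.≟ k) ×-dec ¬? (GraphFamily.containsMember? F X))
  (length (allEdges n)) (λ { _ (X , refl , _) → e≤ X })
... | inj₁ (_ , (X , refl , free) , max) =
      _ , largest X free (λ Y free′ → max _ (Y , refl , free′))
... | inj₂ nothing-free = 0 , none (λ Y free → nothing-free _ (Y , refl , free))

------------------------------------------------------------------------
-- The quantities compared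

lbal : ∀ {v} → ℕ → Graph v → ℕ
lbal n G = proj₁ (lbal-exists n G)

ex : ℕ → GraphFamily → ℕ
ex n F = proj₁ (ex-exists n F)

ℋ : ∀ {v} → Graph v → GraphFamily
ℋ G = record
  { Member          = HalfSubgraph G
  ; containsMember? = containsHalfSubgraph? G
  }

{-# OPTIONS --safe #-}

-- Put k = ⌊C(n,2)/2⌋ + ⌈ex(n,ℋ(G))/2⌉. If |R|, |B| > k, then
-- |R ∩ B| = |R| + |B| − C(n,2) > ex(n,ℋ(G)), so R ∩ B contains a copy of
-- some H ⊆ G with ⌊e(G)/2⌋ edges. Since n ≥ |V|, the copy of H extends to
-- a copy of G; its edges outside H go to a color they admit, and the edges
-- of H, which admit both, are then distributed so as to restore the balance.
module Submission where

open import Defs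
open import Data.Nat.Base as ℕ using (ℕ; ⌈_/2⌉)
open import Data.Nat.Combinatorics using (_C_)
open import Data.Integer.Base using (+_)
open import Data.Rational.Base using (_≤_; _+_; _*_; _/_; ½)

open import Data.Empty.Irrelevant renaming (⊥-elim to ⊥-elim-irr)
open import Data.Fin.Base as Fin using (Fin; zero; suc)
import Data.Fin.Permutation.Components as Components
import Data.Fin.Properties as Fin
import Data.Integer.Base as ℤ
import Data.Integer.Properties as ℤ
open import Data.List.Base
  using (List; []; _∷_; length; map; filter; allFin)
open import Data.List.Membership.Propositional using (_∈_)
open import Data.List.Membership.Propositional.Properties
  using (∈-map⁺; ∈-map⁻; ∈-filter⁺; ∈-filter⁻; ∈-lookup)
import Data.List.Membership.Setoid.Properties as Membership
open import Data.List.Properties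
  using (length-++; length-map; length-tabulate; length-filter)
open import Data.List.Relation.Binary.Subset.Propositional using (_⊆_)
open import Data.List.Relation.Ternary.Interleaving.Propositional
  using (Interleaving; []; consˡ; consʳ)
open import Data.List.Relation.Ternary.Interleaving.Properties
  using (interleave-length)
open import Data.List.Relation.Unary.All as All using (All; []; _∷_)
open import Data.List.Relation.Unary.AllPairs using ([])
import Data.List.Relation.Unary.Any as Any
open import Data.List.Relation.Unary.Unique.Propositional using (Unique)
import Data.List.Relation.Unary.Unique.Propositional.Properties as Unique
open import Data.Nat.Base using (zero; suc; z≤n; s≤s; ∣_-_∣; ⌊_/2⌋)
open import Data.Nat.Combinatorics using (nC1≡n; nCk+nC[k+1]≡[n+1]C[k+1])
import Data.Nat.Properties as ℕ
open import Data.Nat.Tactic.RingSolver using (solve-∀)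
open import Data.Product.Base using (∃; ∃₂; _×_; _,_; proj₂)
import Data.Rational.Base as ℚ
import Data.Rational.Properties as ℚ
open import Data.Rational.Unnormalised.Base as ℚᵘ using (mkℚᵘ; *≤*)
import Data.Rational.Unnormalised.Properties as ℚᵘ
open import Data.Sum.Base using (_⊎_; inj₁; inj₂)
open import Function.Base using (_∘_)
open import Function.Bundles using (_↣_; mk↣; Injection)
open import Function.Construct.Composition using (_↣-∘_)
open import Level using (Level)
open import Relation.Binary.Definitions using (tri<; tri≈; tri>)
open import Relation.Binary.PropositionalEquality
  using (_≡_; _≢_; refl; sym; trans; cong; cong₂; subst; subst₂; setoid;
         module ≡-Reasoning)
open import Relation.Nullary.Decidable
  using (yes; no; _×-dec_; dec-true; dec-false)
open import Relation.Nullary.Negation using (contradiction)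
open import Relation.Unary using (Pred; Decidable)

open Injection using (to; injective)

private
  variable
    m n v : ℕ
    p q   : Level
    A     : Set

-- Rounded halves, and the passage from ℕ to ℚ.

2⌊m/2⌋≤m : ∀ m → ⌊ m /2⌋ ℕ.+ ⌊ m /2⌋ ℕ.≤ m
2⌊m/2⌋≤m m = ℕ.≤-trans (ℕ.+-monoʳ-≤ ⌊ m /2⌋ (ℕ.⌊n/2⌋≤⌈n/2⌉ m))
                       (ℕ.≤-reflexive (ℕ.⌊n/2⌋+⌈n/2⌉≡n m))

m≤2⌈m/2⌉ : ∀ m → m ℕ.≤ ⌈ m /2⌉ ℕ.+ ⌈ m /2⌉
m≤2⌈m/2⌉ m = ℕ.≤-trans (ℕ.≤-reflexive (sym (ℕ.⌊n/2⌋+⌈n/2⌉≡n m)))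
                       (ℕ.+-monoˡ-≤ ⌈ m /2⌉ (ℕ.⌊n/2⌋≤⌈n/2⌉ m))

⌈m/2⌉≤1+⌊m/2⌋ : ∀ m → ⌈ m /2⌉ ℕ.≤ suc ⌊ m /2⌋
⌈m/2⌉≤1+⌊m/2⌋ 0             = z≤n
⌈m/2⌉≤1+⌊m/2⌋ 1             = ℕ.≤-refl
⌈m/2⌉≤1+⌊m/2⌋ (suc (suc m)) = s≤s (⌈m/2⌉≤1+⌊m/2⌋ m)

m≤1+2⌊m/2⌋ : ∀ m → m ℕ.≤ suc (⌊ m /2⌋ ℕ.+ ⌊ m /2⌋)
m≤1+2⌊m/2⌋ m = begin
  m                           ≡⟨ ℕ.⌊n/2⌋+⌈n/2⌉≡n m ⟨
  ⌊ m /2⌋ ℕ.+ ⌈ m /2⌉         ≤⟨ ℕ.+-monoʳ-≤ ⌊ m /2⌋ (⌈m/2⌉≤1+⌊m/2⌋ m) ⟩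
  ⌊ m /2⌋ ℕ.+ suc ⌊ m /2⌋     ≡⟨ ℕ.+-suc ⌊ m /2⌋ ⌊ m /2⌋ ⟩
  suc (⌊ m /2⌋ ℕ.+ ⌊ m /2⌋)   ∎
  where open ℕ.≤-Reasoning

∣⌊m/2⌋-⌈m/2⌉∣≤1 : ∀ m → ∣ ⌊ m /2⌋ - ⌈ m /2⌉ ∣ ℕ.≤ 1
∣⌊m/2⌋-⌈m/2⌉∣≤1 0             = z≤n
∣⌊m/2⌋-⌈m/2⌉∣≤1 1             = ℕ.≤-refl
∣⌊m/2⌋-⌈m/2⌉∣≤1 (suc (suc m)) = ∣⌊m/2⌋-⌈m/2⌉∣≤1 m

-- Doubling removes the floor, since `⌊ d /2⌋ + ⌊ d /2⌋` is at most `d`. The comparison is made on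
-- unnormalised rationals, whose denominators compute.
fromℕ≤½*+ : ∀ {a c} d → a ℕ.≤ ⌊ d /2⌋ ℕ.+ c →
            (+ a / 1) ≤ (½ * (+ d / 1)) + (+ c / 1)
fromℕ≤½*+ {a} {c} d a≤ = ℚ.toℚᵘ-cancel-≤ (begin
  ℚ.toℚᵘ (+ a / 1)                      ≃⟨ ℚ.toℚᵘ-fromℚᵘ (mkℚᵘ (+ a) 0) ⟩
  mkℚᵘ (+ a) 0                          ≤⟨ *≤* (subst₂ ℤ._≤_ lhs rhs (ℤ.+≤+ 2a≤)) ⟩
  (mkℚᵘ (+ 1) 1 ℚᵘ.* mkℚᵘ (+ d) 0) ℚᵘ.+ mkℚᵘ (+ c) 0
    ≃⟨ ℚᵘ.+-cong (ℚᵘ.*-cong (ℚᵘ.≃-refl {ℚ.toℚᵘ ½}) (ℚ.toℚᵘ-fromℚᵘ (mkℚᵘ (+ d) 0)))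
                 (ℚ.toℚᵘ-fromℚᵘ (mkℚᵘ (+ c) 0)) ⟨
  (ℚ.toℚᵘ ½ ℚᵘ.* ℚ.toℚᵘ (+ d / 1)) ℚᵘ.+ ℚ.toℚᵘ (+ c / 1)
    ≃⟨ ℚᵘ.+-congˡ _ (ℚ.toℚᵘ-homo-* ½ (+ d / 1)) ⟨
  ℚ.toℚᵘ (½ * (+ d / 1)) ℚᵘ.+ ℚ.toℚᵘ (+ c / 1)
    ≃⟨ ℚ.toℚᵘ-homo-+ (½ * (+ d / 1)) (+ c / 1) ⟨
  ℚ.toℚᵘ ((½ * (+ d / 1)) + (+ c / 1))  ∎)
  where
  open ℚᵘ.≤-Reasoning
  -- The inequality after cross-multiplication: the left side has denominator 1, the right side 2.
  2a≤ : a ℕ.* 2 ℕ.≤ d ℕ.+ c ℕ.* 2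
  2a≤ = ℕ.≤-trans (ℕ.*-monoˡ-≤ 2 a≤)
        (ℕ.≤-trans (ℕ.≤-reflexive (rearrange ⌊ d /2⌋ c)) (ℕ.+-monoˡ-≤ (c ℕ.* 2) (2⌊m/2⌋≤m d)))
    where
    rearrange : ∀ x y → (x ℕ.+ y) ℕ.* 2 ≡ (x ℕ.+ x) ℕ.+ y ℕ.* 2
    rearrange = solve-∀
  lhs : + (a ℕ.* 2) ≡ + a ℤ.* + 2
  lhs = ℤ.pos-* a 2
  rhs : + (d ℕ.+ c ℕ.* 2) ≡ (+ 1 ℤ.* + d ℤ.* + 1 ℤ.+ + c ℤ.* + 2) ℤ.* + 1
  rhs = sym (trans (ℤ.*-identityʳ (+ 1 ℤ.* + d ℤ.* + 1 ℤ.+ + c ℤ.* + 2))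
    (cong₂ ℤ._+_ (trans (ℤ.*-identityʳ (+ 1 ℤ.* + d)) (ℤ.*-identityˡ (+ d)))
                 (sym (ℤ.pos-* c 2))))

-- Counting in lists

Unique-⊆⇒length≤ : ∀ {xs ys : List A} → Unique xs → xs ⊆ ys → length xs ℕ.≤ length ys
Unique-⊆⇒length≤ {xs = xs} uniq xs⊆ys =
  Fin.injective⇒≤ {f = λ i → Any.index (xs⊆ys (∈-lookup {xs = xs} i))}
    (lookup-injective uniq ∘ Membership.index-injective (setoid _) _ _)

module _ {P : Pred A p} {Q : Pred A q} (P? : Decidable P) (Q? : Decidable Q)
         (cover : ∀ x → P x ⊎ Q x) where

  -- Inclusion-exclusion, where `cover` makes the union of the two filtered lists all of `xs`.
  length-filter-cover : ∀ xs → length (filter P? xs) ℕ.+ length (filter Q? xs) ≡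
    length xs ℕ.+ length (filter (λ x → P? x ×-dec Q? x) xs)
  length-filter-cover [] = refl
  length-filter-cover (x ∷ xs) with P? x | Q? x
  ... | yes _ | yes _ = cong suc (trans (ℕ.+-suc _ _)
                          (trans (cong suc (length-filter-cover xs)) (sym (ℕ.+-suc _ _))))
  ... | yes _ | no _  = cong suc (length-filter-cover xs)
  ... | no _  | yes _ = trans (ℕ.+-suc _ _) (cong suc (length-filter-cover xs))
  ... | no ¬p | no ¬q with cover x
  ...   | inj₁ px = contradiction px ¬p
  ...   | inj₂ qx = contradiction qx ¬q

  SplitAt : ℕ → List A → Set _
  SplitAt k xs = ∃₂ λ ys zs →
    Interleaving ys zs xs × All P ys × All Q zs × length ys ≡ k

  private
    left : ∀ {x xs k} → P x → SplitAt k xs → SplitAt (suc k) (x ∷ xs)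
    left px (ys , zs , i , ps , qs , eq) =
      _ ∷ ys , zs , consˡ i , px ∷ ps , qs , cong suc eq

    right : ∀ {x xs k} → Q x → SplitAt k xs → SplitAt k (x ∷ xs)
    right qx (ys , zs , i , ps , qs , eq) =
      ys , _ ∷ zs , consʳ i , ps , qx ∷ qs , eq

  -- The first bound says that at most k elements are forced to the left.
  split-cover : ∀ xs k → length xs ℕ.≤ k ℕ.+ length (filter Q? xs) →
                k ℕ.≤ length (filter P? xs) → SplitAt k xs
  split-cover [] zero _ _ = [] , [] , [] , [] , [] , refl
  split-cover (x ∷ xs) k l≤ k≤ with P? x | Q? x
  split-cover (x ∷ xs) zero    (s≤s l≤) _        | yes _  | yes qx =
    right qx (split-cover xs zero l≤ z≤n)
  split-cover (x ∷ xs) (suc k) (s≤s l≤) (s≤s k≤) | yes px | yes qx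
    with length xs ℕ.≤? k ℕ.+ length (filter Q? xs)
  ... | yes l≤′ = left px (split-cover xs k l≤′ k≤)
  -- The rest has more than `k` elements beyond those satisfying `Q`. By inclusion-exclusion at
  -- least `suc k` of its elements satisfy `P`, so the left side can still be filled without `x`.
  ... | no l≰   = right qx (split-cover xs (suc k) (subst (length xs ℕ.≤_) (ℕ.+-suc _ _) l≤)
    (ℕ.+-cancelʳ-≤ (length (filter Q? xs)) _ _
      (ℕ.≤-trans (ℕ.≰⇒> l≰)
        (ℕ.≤-trans (ℕ.m≤m+n _ _) (ℕ.≤-reflexive (sym (length-filter-cover xs)))))))
  split-cover (x ∷ xs) zero    l≤       _        | yes _  | no _ =
    contradiction (length-filter Q? xs) (ℕ.<⇒≱ l≤)
  split-cover (x ∷ xs) (suc k) (s≤s l≤) (s≤s k≤) | yes px | no _ =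
    left px (split-cover xs k l≤ k≤)
  split-cover (x ∷ xs) k       l≤       k≤       | no _   | yes qx =
    right qx (split-cover xs k (ℕ.≤-pred (subst (suc (length xs) ℕ.≤_) (ℕ.+-suc k _) l≤)) k≤)
  split-cover (x ∷ xs) k       l≤       k≤       | no ¬p  | no ¬q with cover x
  ... | inj₁ px = contradiction px ¬p
  ... | inj₂ qx = contradiction qx ¬q

  -- By inclusion-exclusion `#P` and `#Q` are each at least `#both`, because neither exceeds `l`; so
  -- both reach `⌊ l /2⌋`. Their sum is at least `l`, so one of them also reaches `⌈ l /2⌉`, and
  -- that side receives the larger share.
  balanced-split : ∀ xs → ⌊ length xs /2⌋ ℕ.≤ length (filter (λ x → P? x ×-dec Q? x) xs) →
    ∃₂ λ ys zs → Interleaving ys zs xs × All P ys × All Q zs ×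
                 ∣ length ys - length zs ∣ ℕ.≤ 1
  balanced-split xs half≤both = result
    where
    l = length xs
    #P = length (filter P? xs)
    #Q = length (filter Q? xs)
    #both = length (filter (λ x → P? x ×-dec Q? x) xs)

    eq : #P ℕ.+ #Q ≡ l ℕ.+ #both
    eq = length-filter-cover xs

    half≤#P : ⌊ l /2⌋ ℕ.≤ #P
    half≤#P = ℕ.≤-trans half≤both (ℕ.+-cancelˡ-≤ l _ _
      (ℕ.≤-trans (ℕ.≤-reflexive (trans (sym eq) (ℕ.+-comm #P #Q)))
                 (ℕ.+-monoˡ-≤ #P (length-filter Q? xs))))

    half≤#Q : ⌊ l /2⌋ ℕ.≤ #Q
    half≤#Q = ℕ.≤-trans half≤both (ℕ.+-cancelˡ-≤ l _ _
      (ℕ.≤-trans (ℕ.≤-reflexive (sym eq)) (ℕ.+-monoˡ-≤ #Q (length-filter P? xs))))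

    Result = ∃₂ λ ys zs → Interleaving ys zs xs × All P ys × All Q zs ×
             ∣ length ys - length zs ∣ ℕ.≤ 1

    conclude : ∀ {k k′} → k ℕ.+ k′ ≡ l → ∣ k - k′ ∣ ℕ.≤ 1 → SplitAt k xs → Result
    conclude {k} {k′} k+k′≡l diff (ys , zs , i , ps , qs , refl) =
      ys , zs , i , ps , qs ,
      subst (λ j → ∣ length ys - j ∣ ℕ.≤ 1)
        (ℕ.+-cancelˡ-≡ (length ys) _ _ (trans k+k′≡l (interleave-length i))) diff

    result : Result
    result with ⌈ l /2⌉ ℕ.≤? #Q
    ... | yes ≤#Q = conclude (ℕ.⌊n/2⌋+⌈n/2⌉≡n l) (∣⌊m/2⌋-⌈m/2⌉∣≤1 l)
      (split-cover xs ⌊ l /2⌋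
        (subst (ℕ._≤ ⌊ l /2⌋ ℕ.+ #Q) (ℕ.⌊n/2⌋+⌈n/2⌉≡n l) (ℕ.+-monoʳ-≤ ⌊ l /2⌋ ≤#Q)) half≤#P)
    ... | no ≰#Q = conclude ⌈⌉+⌊⌋≡l
      (subst (ℕ._≤ 1) (ℕ.∣-∣-comm ⌊ l /2⌋ ⌈ l /2⌉) (∣⌊m/2⌋-⌈m/2⌉∣≤1 l))
      (split-cover xs ⌈ l /2⌉
        (subst (ℕ._≤ ⌈ l /2⌉ ℕ.+ #Q) ⌈⌉+⌊⌋≡l (ℕ.+-monoʳ-≤ ⌈ l /2⌉ half≤#Q)) ⌈⌉≤#P)
      where
      ⌈⌉+⌊⌋≡l : ⌈ l /2⌉ ℕ.+ ⌊ l /2⌋ ≡ l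
      ⌈⌉+⌊⌋≡l = trans (ℕ.+-comm ⌈ l /2⌉ _) (ℕ.⌊n/2⌋+⌈n/2⌉≡n l)

      ⌈⌉≤#P : ⌈ l /2⌉ ℕ.≤ #P
      -- Twice `⌈ l /2⌉` exceeds `l` by at most 1, and this unit is recovered from the strict
      -- inequality `#Q < ⌈ l /2⌉`.
      ⌈⌉≤#P = ℕ.+-cancelʳ-≤ ⌈ l /2⌉ _ _ (begin
        ⌈ l /2⌉ ℕ.+ ⌈ l /2⌉  ≤⟨ ℕ.+-monoʳ-≤ ⌈ l /2⌉ (⌈m/2⌉≤1+⌊m/2⌋ l) ⟩
        ⌈ l /2⌉ ℕ.+ suc ⌊ l /2⌋ ≡⟨ ℕ.+-suc _ _ ⟩
        suc (⌈ l /2⌉ ℕ.+ ⌊ l /2⌋) ≡⟨ cong suc ⌈⌉+⌊⌋≡l ⟩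
        suc l                ≤⟨ s≤s (ℕ.m≤m+n l #both) ⟩
        suc (l ℕ.+ #both)    ≡⟨ cong suc eq ⟨
        suc (#P ℕ.+ #Q)      ≡⟨ ℕ.+-suc #P #Q ⟨
        #P ℕ.+ suc #Q        ≤⟨ ℕ.+-monoʳ-≤ #P (ℕ.≰⇒> ≰#Q) ⟩
        #P ℕ.+ ⌈ l /2⌉       ∎)
        where open ℕ.≤-Reasoning

-- Injections between finite sets

transpose-matchˡ : ∀ (i j : Fin n) → Components.transpose i j i ≡ j
transpose-matchˡ i j rewrite dec-true (i Fin.≟ i) refl = refl

transpose-mismatch : ∀ {i j k : Fin n} → k ≢ i → k ≢ j → Components.transpose i j k ≡ k
transpose-mismatch {i = i} {j} {k} k≢i k≢j
  rewrite dec-false (k Fin.≟ i) k≢i | dec-false (k Fin.≟ j) k≢j = refl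

transpose-injection : (i j : Fin n) → Fin n ↣ Fin n
transpose-injection i j = mk↣ {to = Components.transpose i j} λ eq →
  trans (sym (Components.transpose-inverse j i))
        (trans (cong (Components.transpose j i) eq) (Components.transpose-inverse j i))

suc-injection : Fin n ↣ Fin (suc n)
suc-injection = mk↣ Fin.suc-injective

-- Turns a placement of a subgraph into a placement of the whole graph. By induction `f` is already
-- right on all of `h` except its value at `zero`; a transposition in the target then repairs that
-- one value.
extend-injection : ∀ {m v n} → v ℕ.≤ n → (h : Fin m ↣ Fin v) (g : Fin m ↣ Fin n) →
                   ∃ λ (f : Fin v ↣ Fin n) → ∀ i → to f (to h i) ≡ to g i
extend-injection {zero} v≤n h g = mk↣ (Fin.inject≤-injective v≤n v≤n _ _) , λ ()
extend-injection {suc m} v≤n h g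
  with extend-injection v≤n (h ↣-∘ suc-injection) (g ↣-∘ suc-injection)
... | f , f∘h≗g = transpose-injection (to f (to h zero)) (to g zero) ↣-∘ f , agree
  where
  agree : ∀ i → Components.transpose (to f (to h zero)) (to g zero) (to f (to h i)) ≡ to g i
  agree zero    = transpose-matchˡ (to f (to h zero)) (to g zero)
  -- The transposition fixes the values that were already right: injectivity of `f` and `h`, and of
  -- `g`, keeps them away from the two swapped points.
  agree (suc i) = trans
    (transpose-mismatch
      (λ eq → Fin.0≢1+n (sym (injective h (injective f eq))))
      (λ eq → Fin.0≢1+n (sym (injective g (trans (sym (f∘h≗g i)) eq)))))
    (f∘h≗g i)

-- Edges

Edge-≡ : {e e′ : Edge n} → lo e ≡ lo e′ → hi e ≡ hi e′ → e ≡ e′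
Edge-≡ {e = mkEdge i j i<j} {mkEdge i j i<j′} refl refl =
  cong (mkEdge i j) (Fin.<-irrelevant i<j i<j′)

edge-sym : ∀ {i j : Fin n} .(i≢j : i ≢ j) .(j≢i : j ≢ i) → edge i j i≢j ≡ edge j i j≢i
edge-sym {i = i} {j} i≢j j≢i with Fin.<-cmp i j | Fin.<-cmp j i
... | tri< _ _ _   | tri> _ _ _   = Edge-≡ refl refl
... | tri> _ _ _   | tri< _ _ _   = Edge-≡ refl refl
... | tri< _ _ j≮i | tri< j<i _ _ = contradiction j<i j≮i
... | tri< _ i≢j _ | tri≈ _ j≡i _ = contradiction (sym j≡i) i≢j
... | tri≈ _ i≡j _ | tri< _ j≢i _ = contradiction (sym i≡j) j≢i
... | tri≈ _ i≡j _ | tri> _ j≢i _ = contradiction (sym i≡j) j≢i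
... | tri> _ i≢j _ | tri≈ _ j≡i _ = contradiction (sym j≡i) i≢j
... | tri> i≮j _ _ | tri> _ _ i<j = contradiction i<j i≮j
... | tri≈ _ i≡j _ | tri≈ _ _ _   = ⊥-elim-irr (i≢j i≡j)

edge-ends : ∀ (i j : Fin n) .(i≢j : i ≢ j) →
            (lo (edge i j i≢j) ≡ i × hi (edge i j i≢j) ≡ j) ⊎
            (lo (edge i j i≢j) ≡ j × hi (edge i j i≢j) ≡ i)
edge-ends i j i≢j with Fin.<-cmp i j
... | tri< _ _ _   = inj₁ (refl , refl)
... | tri≈ _ i≡j _ = ⊥-elim-irr (i≢j i≡j)
... | tri> _ _ _   = inj₂ (refl , refl)

mapEdge-injective : ∀ (f : Fin m ↣ Fin n) {e e′} → mapEdge f e ≡ mapEdge f e′ → e ≡ e′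
mapEdge-injective f {e} {e′} eq
  with edge-ends (to f (lo e)) (to f (hi e)) (λ z → Fin.<-irrefl (injective f z) (lo<hi e))
     | edge-ends (to f (lo e′)) (to f (hi e′)) (λ z → Fin.<-irrefl (injective f z) (lo<hi e′))
... | inj₁ (l , h) | inj₁ (l′ , h′) = Edge-≡
  (injective f (trans (sym l) (trans (cong lo eq) l′)))
  (injective f (trans (sym h) (trans (cong hi eq) h′)))
... | inj₂ (l , h) | inj₂ (l′ , h′) = Edge-≡
  (injective f (trans (sym h) (trans (cong hi eq) h′)))
  (injective f (trans (sym l) (trans (cong lo eq) l′)))
-- If `f` reverses the order of the ends of just one of the two edges, then `lo e` is `hi e′` and
-- `hi e` is `lo e′`, which contradicts `lo<hi`.
... | inj₁ (l , h) | inj₂ (l′ , h′) = contradiction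
  (subst₂ Fin._<_ (injective f (trans (sym l) (trans (cong lo eq) l′)))
                  (injective f (trans (sym h) (trans (cong hi eq) h′))) (lo<hi e))
  (Fin.<-asym (lo<hi e′))
... | inj₂ (l , h) | inj₁ (l′ , h′) = contradiction
  (subst₂ Fin._<_ (injective f (trans (sym h) (trans (cong hi eq) h′)))
                  (injective f (trans (sym l) (trans (cong lo eq) l′))) (lo<hi e))
  (Fin.<-asym (lo<hi e′))

mapEdge-edge : ∀ (f : Fin m ↣ Fin n) {i j} .(i≢j : i ≢ j) .(fi≢fj : to f i ≢ to f j) →
               mapEdge f (edge i j i≢j) ≡ edge (to f i) (to f j) fi≢fj
mapEdge-edge f {i} {j} i≢j fi≢fj with Fin.<-cmp i j
... | tri< _ _ _   = refl
... | tri≈ _ i≡j _ = ⊥-elim-irr (i≢j i≡j)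
-- `edge i j` has stored its ends in swapped order, so the images must be swapped back.
... | tri> _ _ _   = edge-sym {i = to f j} {to f i} (λ eq → fi≢fj (sym eq)) fi≢fj

mapEdge-∘ : ∀ (f : Fin v ↣ Fin n) (h : Fin m ↣ Fin v) (g : Fin m ↣ Fin n) →
            (∀ i → to f (to h i) ≡ to g i) → ∀ e → mapEdge f (mapEdge h e) ≡ mapEdge g e
mapEdge-∘ f h g f∘h≗g e =
  trans (mapEdge-edge f _ (λ eq → Fin.<-irrefl (injective h (injective f eq)) (lo<hi e)))
        (edge-cong (f∘h≗g (lo e)) (f∘h≗g (hi e)))

length-allEdges : ∀ n → length (allEdges n) ≡ n C 2
length-allEdges zero    = refl
length-allEdges (suc n) = begin
  length (allEdges (suc n))
    ≡⟨ length-++ (map (λ j → mkEdge zero (suc j) (s≤s z≤n)) (allFin n)) ⟩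
  length (map (λ j → mkEdge zero (suc j) (s≤s z≤n)) (allFin n)) ℕ.+
  length (map (λ e → mkEdge (suc (lo e)) (suc (hi e)) (s≤s (lo<hi e))) (allEdges n))
    ≡⟨ cong₂ ℕ._+_ (trans (length-map _ (allFin n)) (length-tabulate _))
                   (length-map _ (allEdges n)) ⟩
  -- The `n` edges at vertex `zero` are written as `n C 1`, so that Pascal's rule applies.
  n ℕ.+ length (allEdges n)  ≡⟨ cong₂ ℕ._+_ (sym (nC1≡n n)) (length-allEdges n) ⟩
  n C 1 ℕ.+ n C 2            ≡⟨ nCk+nC[k+1]≡[n+1]C[k+1] n 1 ⟩
  suc n C 2                  ∎
  where open ≡-Reasoning

allEdges-unique : ∀ n → Unique (allEdges n)
allEdges-unique zero    = []
allEdges-unique (suc n) = Unique.++⁺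
  (Unique.map⁺ (Fin.suc-injective ∘ cong hi) (Unique.allFin⁺ n))
  (Unique.map⁺ (λ eq → Edge-≡ (Fin.suc-injective (cong lo eq)) (Fin.suc-injective (cong hi eq)))
               (allEdges-unique n))
  -- The two blocks are disjoint: `lo` is `zero` in the first and a successor in the second.
  λ { (p , q) → Fin.0≢1+n (trans (sym (cong lo (proj₂ (proj₂ (∈-map⁻ _ p)))))
                                 (cong lo (proj₂ (proj₂ (∈-map⁻ _ q))))) }

-- Bicolored edges and balanced copies.

-- No palette is empty. This supplies `cover` twice: for counting over all edges and for splitting a
-- copy of `G`.
∈ᵖ-cover : ∀ p → red ∈ᵖ p ⊎ blue ∈ᵖ p
∈ᵖ-cover r  = inj₁ red∈r
∈ᵖ-cover b  = inj₂ blue∈b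
∈ᵖ-cover rb = inj₁ red∈rb

ex-bound : ∀ (F : GraphFamily) (X : Graph n) → GraphFamily.Free F X → e[ X ] ℕ.≤ ex n F
ex-bound {n} F X = bound (proj₂ (ex-exists n F))
  where
  bound : ∀ {k} → IsEx n F k → GraphFamily.Free F X → e[ X ] ℕ.≤ k
  bound (largest _ _ max) free = max X free
  -- The default value 0 never has to serve as a bound, since `X` itself is free.
  bound (none ¬free)      free = contradiction free (¬free X)

module _ (L : ListColoring n) where

  private
    red? : Decidable (λ e → red ∈ᵖ L e)
    red? e = red ∈ᵖ? L e

    blue? : Decidable (λ e → blue ∈ᵖ L e)
    blue? e = blue ∈ᵖ? L e

  bicolored : Graph n
  bicolored = mkGraph (filter (λ e → red? e ×-dec blue? e) (allEdges n))
                      (Unique.filter⁺ _ (allEdges-unique n))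

  many-bicolored : ∀ x → ⌊ n C 2 /2⌋ ℕ.+ ⌈ x /2⌉ ℕ.< length (class red L) →
                   ⌊ n C 2 /2⌋ ℕ.+ ⌈ x /2⌉ ℕ.< length (class blue L) →
                   x ℕ.< e[ bicolored ]
  many-bicolored x k<R k<B = ℕ.+-cancelˡ-≤ (n C 2) _ _ (begin
    -- The two strict hypotheses provide two spare units: one pays for rounding half of `n C 2`
    -- down, the other makes the conclusion strict.
    n C 2 ℕ.+ suc x             ≤⟨ ℕ.+-mono-≤ (m≤1+2⌊m/2⌋ (n C 2)) (s≤s (m≤2⌈m/2⌉ x)) ⟩
    suc (h ℕ.+ h) ℕ.+ suc (c ℕ.+ c)  ≡⟨ rearrange h c ⟩
    suc (h ℕ.+ c) ℕ.+ suc (h ℕ.+ c)  ≤⟨ ℕ.+-mono-≤ k<R k<B ⟩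
    length (class red L) ℕ.+ length (class blue L)
      ≡⟨ length-filter-cover red? blue? (∈ᵖ-cover ∘ L) (allEdges n) ⟩
    length (allEdges n) ℕ.+ e[ bicolored ]
      ≡⟨ cong (ℕ._+ e[ bicolored ]) (length-allEdges n) ⟩
    n C 2 ℕ.+ e[ bicolored ]    ∎)
    where
    open ℕ.≤-Reasoning
    h = ⌊ n C 2 /2⌋
    c = ⌈ x /2⌉
    rearrange : ∀ h c → suc (h ℕ.+ h) ℕ.+ suc (c ℕ.+ c) ≡ suc (h ℕ.+ c) ℕ.+ suc (h ℕ.+ c)
    rearrange = solve-∀

  half-bicolored⇒balanced : (G : Graph v) → v ℕ.≤ n →
    ContainsMember (HalfSubgraph G) bicolored → HasBalancedCopy G L
  half-bicolored⇒balanced G v≤n (m , H , ((h , H⊆G) , e[H]≡ , _) , g , H⊆bi)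
    with extend-injection v≤n h g
  ... | f , f∘h≗g =
    let E₁ , E₂ , i , ps , qs , diff = balanced-split red? blue? (∈ᵖ-cover ∘ L)
                                         (copyEdges f G) half≤both
    in f , E₁ , E₂ , i ,
       (λ e∈ → ∈-filter⁺ red? (∈-allEdges _) (All.lookup ps e∈)) ,
       (λ e∈ → ∈-filter⁺ blue? (∈-allEdges _) (All.lookup qs e∈)) , diff
    where
    both? = λ e → red? e ×-dec blue? e

    -- Since `f` after `h` agrees with `g`, the bicolored copy of `H` lies inside the copy of `G`
    -- placed by `f`.
    copy⊆ : copyEdges g H ⊆ filter both? (copyEdges f G)
    copy⊆ e∈ with ∈-map⁻ (mapEdge g) e∈
    ... | e , e∈H , refl = ∈-filter⁺ both?
      (subst (_∈ copyEdges f G) (mapEdge-∘ f h g f∘h≗g e)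
        (∈-map⁺ (mapEdge f) (H⊆G (∈-map⁺ (mapEdge h) e∈H))))
      (proj₂ (∈-filter⁻ both? {xs = allEdges n} (H⊆bi e∈)))

    -- The copy of `H` consists of `⌊ e[ G ] /2⌋` distinct edges, as `mapEdge g` is injective, so
    -- the copy of `G` has at least that many bicolored edges.
    half≤both : ⌊ length (copyEdges f G) /2⌋ ℕ.≤ length (filter both? (copyEdges f G))
    half≤both = subst (ℕ._≤ length (filter both? (copyEdges f G)))
      (trans (length-map (mapEdge g) (edges H))
        (trans e[H]≡ (cong ⌊_/2⌋ (sym (length-map (mapEdge f) (edges G))))))
      (Unique-⊆⇒length≤ (Unique.map⁺ (mapEdge-injective g) (unique H)) copy⊆)

forcesBalancedCopy : ∀ (G : Graph v) n → v ℕ.≤ n →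
  ForcesBalancedCopy n G (⌊ n C 2 /2⌋ ℕ.+ ⌈ ex n (ℋ G) /2⌉)
forcesBalancedCopy G n v≤n L k<R k<B with containsHalfSubgraph? G (bicolored L)
... | yes c = half-bicolored⇒balanced L G v≤n c
-- A free `bicolored L` would have at most `ex n (ℋ G)` edges.
... | no ¬c = contradiction (ex-bound (ℋ G) (bicolored L) ¬c)
                            (ℕ.<⇒≱ (many-bicolored L _ k<R k<B))

theorem7 : ∀ {v : ℕ} (G : Graph v) (n : ℕ) → v ℕ.≤ n →
    (+ lbal n G / 1) ≤ (½ * (+ (n C 2) / 1)) + (+ ⌈ ex n (ℋ G) /2⌉ / 1)
-- Minimality of `lbal n G` gives the bound with `⌊ n C 2 /2⌋`, which is then relaxed to the exact
-- half.
theorem7 G n v≤n = fromℕ≤½*+ (n C 2)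
  (proj₂ (proj₂ (lbal-exists n G)) _ (forcesBalancedCopy G n v≤n))
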